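{- Let $n_1,\dots,n_d\ge 1$ and let $C\subseteq\mathrm{HS}(n_1,\dots,n_d)$ be a code with $M=|C|\ge 1$ codewords such that $d(x,y)\ge\delta$ for all distinct $x,y\in C$, where $\delta>0$. Put $r=1-\sum_{i=1}^d (d\,n_i)^{ -1}$ and suppose $rd<\delta$. Then \[M\le\left\lfloor\frac{\delta}{\delta-rd}\right\rfloor.\]
   Context: For an integer $m$ let $[m]=\{0,\dots,m-1\}$. The cuboidal Hamming space $\mathrm{HS}(n_1,\dots,n_d)$ is $[n_1]\times\cdots\times[n_d]$ with Hamming distance $d(x,y)=|\{i:x_i\ne y_i\}|$. -}

module Defs where

open import Data.Fin using (Fin; _≟_)
open import Data.Fin.Properties using (nonZeroIndex)
open import Data.Integer using (+_)
open import Data.Nat as ℕ using (ℕ)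
open import Data.Nat.Properties using (m*n≢0)
open import Data.Rational as ℚ using (ℚ; 1ℚ; _/_; _-_; -_; _<_)
open import Data.Rational.Properties using (+-0-commutativeMonoid; +-monoˡ-<; +-inverseʳ)
open import Data.Vec using (Vec; lookup; count; allFin)
open import Data.Vec.Relation.Unary.All using (All)
open import Data.Vec.Relation.Unary.All.Properties using (lookup⁺)
open import Relation.Binary.PropositionalEquality using (subst)
open import Relation.Nullary.Decidable using (¬?)

open import Algebra.Properties.CommutativeMonoid.Sum +-0-commutativeMonoid using (sum)

-- A point is a heterogeneous tuple (x₁ , … , x_d) with xᵢ : Fin nᵢ, so
-- propositional equality of points is coordinatewise equality.
HS : ∀ {d} → Vec ℕ d → Set
HS ns = All Fin ns

hamming : ∀ {d} {ns : Vec ℕ d} → HS ns → HS ns → ℕ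
hamming {d} x y = count (λ i → ¬? (lookup⁺ x i ≟ lookup⁺ y i)) (allFin d)

fromℕ : ℕ → ℚ
fromℕ m = + m / 1

-- r = 1 - Σᵢ 1 / (d nᵢ); an index i : Fin d already forces d ≠ 0.
ratio : ∀ {d} (ns : Vec ℕ d) → (∀ i → 1 ℕ.≤ lookup ns i) → ℚ
ratio {d} ns ns≥1 = 1ℚ - sum λ i →
  let instance
        d≢0  = nonZeroIndex i
        nᵢ≢0 = ℕ.>-nonZero (ns≥1 i)
  in (+ 1 / (d ℕ.* lookup ns i)) {{m*n≢0 d (lookup ns i)}}

q<p⇒p-q≢0 : ∀ {p q} → q < p → ℚ.NonZero (p - q)
q<p⇒p-q≢0 {p} {q} q<p =
  ℚ.>-nonZero (subst (_< p - q) (+-inverseʳ q) (+-monoˡ-< (- q) q<p))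

{-# OPTIONS --safe #-}

-- Count the ordered pairs of codewords by their distances. Summing over all
-- pairs, the distances total at least M (M - 1) δ. On the other hand, by
-- Cauchy–Schwarz applied to the numbers of codewords with a given i-th symbol,
-- at least M² / nᵢ pairs agree in coordinate i, so the distances total at most
-- M² (d - Σᵢ 1 / nᵢ) = M² r d. Comparing the two gives M (δ - r d) ≤ δ.

module Submission where

open import Defs
open import Algebra.Bundles using (CommutativeRing)
open import Data.Bool using (true; false; if_then_else_)
open import Data.Fin using (Fin; zero; suc; _≟_)
open import Data.Fin.Properties using (nonZeroIndex)
import Data.Integer as ℤ
open import Data.Integer using (+_) renaming (_≤_ to _≤ℤ_)
import Data.Integer.DivMod as ℤ
import Data.Integer.Properties as ℤ
import Data.List as List
open import Data.List using (List; length)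
open import Data.List.Membership.Propositional using (_∈_)
open import Data.List.Membership.Propositional.Properties using (∈-lookup)
import Data.List.Relation.Unary.All as All
open import Data.List.Relation.Unary.AllPairs using (_∷_)
open import Data.List.Relation.Unary.Unique.Propositional using (Unique)
import Data.Nat as ℕ
open import Data.Nat using (ℕ) renaming (_≤_ to _≤ℕ_)
import Data.Nat.Coprimality as Coprime
open import Data.Nat.Properties using (m*n≢0)
import Data.Rational as ℚ
open import Data.Rational using (ℚ; 0ℚ; _≤_; _<_; _*_; _-_; _÷_; floor; 1ℚ; mkℚ; _+_; -_; 1/_)
open import Data.Rational.Properties hiding (_≟_)
open import Data.Rational.Solver using (module +-*-Solver)
open import Data.Sum using (inj₁; inj₂)
open import Data.Vec using (Vec; lookup; count; tabulate)
open import Data.Vec.Relation.Unary.All.Properties using (lookup⁺)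
open import Function using (_∘_; id)
open import Function.Definitions using (Injective)
open import Relation.Binary.PropositionalEquality using (_≡_; _≢_; refl; sym; trans; cong; cong₂; subst)
open import Relation.Nullary using (Dec; does; yes; no; contradiction)
open import Relation.Nullary.Decidable using (¬?)
open import Relation.Unary using (Pred; Decidable)

open import Algebra.Properties.Semiring.Sum (CommutativeRing.semiring +-*-commutativeRing)
open +-*-Solver using (solve; _:+_; _:*_; _:-_; _:=_; con)

-- Natural numbers among the rationals, and the floor.

n/1 : ℕ → ℚ
n/1 n = mkℚ (+ n) 0 (Coprime.sym (Coprime.1-coprimeTo n))

-- `fromℕ n` is stuck on a gcd when `n` is a variable; on the constructor form `n/1 n` the
-- arithmetic of ℚ computes.
fromℕ≡n/1 : ∀ n → fromℕ n ≡ n/1 n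
fromℕ≡n/1 n = normalize-coprime (Coprime.sym (Coprime.1-coprimeTo n))

fromℕ-suc : ∀ n → fromℕ (ℕ.suc n) ≡ 1ℚ + fromℕ n
fromℕ-suc n = begin-equality
  fromℕ (ℕ.suc n)                 ≡⟨ /-cong {q₁ = 1} {q₂ = 1} (cong (ℤ._+_ (+ 1)) (sym (ℤ.*-identityʳ (+ n)))) refl ⟩
  1ℚ + n/1 n            ≡⟨ cong (_+_ 1ℚ) (fromℕ≡n/1 n) ⟨
  1ℚ + fromℕ n                    ∎
  where open ≤-Reasoning

fromℕ-* : ∀ m n → fromℕ (m ℕ.* n) ≡ fromℕ m * fromℕ n
fromℕ-* m n = begin-equality
  fromℕ (m ℕ.* n)                      ≡⟨ /-cong {q₁ = 1} {q₂ = 1} (ℤ.pos-* m n) refl ⟩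
  n/1 m * n/1 n              ≡⟨ cong₂ _*_ (fromℕ≡n/1 m) (fromℕ≡n/1 n) ⟨
  fromℕ m * fromℕ n                    ∎
  where open ≤-Reasoning

fromℕ-nonNeg : ∀ n → 0ℚ ≤ fromℕ n
fromℕ-nonNeg n = nonNegative⁻¹ (fromℕ n) {{normalize-nonNeg n 1}}

fromℕ-*-1/ : ∀ n .{{_ : ℕ.NonZero n}} → fromℕ n * (+ 1 ℚ./ n) ≡ 1ℚ
fromℕ-*-1/ n@(ℕ.suc k) = begin-equality
  fromℕ n * (+ 1 ℚ./ n)  ≡⟨ cong₂ _*_ (fromℕ≡n/1 n) (normalize-coprime (Coprime.1-coprimeTo n)) ⟩
  -- By computation, `n/1 n` is the reciprocal `1/ q`.
  1/ q * q               ≡⟨ *-inverseˡ q ⟩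
  1ℚ                     ∎
  where
  open ≤-Reasoning
  q = mkℚ (+ 1) k (Coprime.1-coprimeTo n)

-- Division with remainder puts the numerator of `p` strictly below `floor p + 1` times the
-- denominator. Cancelling the denominator leaves n < floor p + 1, a comparison of integers.
fromℕ≤⇒≤floor : ∀ n p → fromℕ n ≤ p → + n ≤ℤ floor p
fromℕ≤⇒≤floor n p@(mkℚ i k _) n≤p =
  subst (+ n ≤ℤ_) (ℤ.pred-suc (floor p))
    (ℤ.i<j⇒i≤pred[j] (ℤ.*-cancelʳ-<-nonNeg {+ n} {ℤ.suc (floor p)} (ℚ.↧ p) n*↧p<))
  where
  open ℤ.≤-Reasoning
  n*↧p< : + n ℤ.* ℚ.↧ p ℤ.< ℤ.suc (floor p) ℤ.* ℚ.↧ p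
  n*↧p< = begin-strict
    + n ℤ.* ℚ.↧ p                   ≤⟨ drop-*≤* (subst (_≤ p) (fromℕ≡n/1 n) n≤p) ⟩
    i ℤ.* + 1                       ≡⟨ ℤ.*-identityʳ i ⟩
    i                               <⟨ ℤ.n<s[n/ℕd]*d i (ℕ.suc k) ⟩
    ℤ.suc (i ℤ./ℕ ℕ.suc k) ℤ.* ℚ.↧ p  ≡⟨ cong (λ q → ℤ.suc q ℤ.* ℚ.↧ p) (ℤ.div-pos-is-/ℕ i (ℕ.suc k)) ⟨
    ℤ.suc (floor p) ℤ.* ℚ.↧ p       ∎

-- Inequalities and finite sums over ℚ.

square-nonNeg : ∀ p → 0ℚ ≤ p * p
square-nonNeg p with ≤-total 0ℚ p
... | inj₁ 0≤p = nonNegative⁻¹ (p * p) {{nonNeg*nonNeg⇒nonNeg p p}}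
  where instance _ = ℚ.nonNegative 0≤p
... | inj₂ p≤0 = nonNegative⁻¹ (p * p) {{nonPos*nonPos⇒nonPos p p}}
  where instance _ = ℚ.nonPositive p≤0

2pq≤p²+q² : ∀ p q → p * q + p * q ≤ q * q + p * p
2pq≤p²+q² p q = begin
  p * q + p * q                        ≡⟨ +-identityʳ _ ⟨
  p * q + p * q + 0ℚ                   ≤⟨ +-monoʳ-≤ (p * q + p * q) (square-nonNeg (q - p)) ⟩
  p * q + p * q + (q - p) * (q - p)    ≡⟨ solve 2 (λ p q → p :* q :+ p :* q :+ (q :- p) :* (q :- p) := q :* q :+ p :* p) refl p q ⟩
  q * q + p * p                        ∎
  where open ≤-Reasoning

sum-mono-≤ : ∀ {n} {f g : Fin n → ℚ} → (∀ i → f i ≤ g i) → sum f ≤ sum g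
sum-mono-≤ {ℕ.zero}  f≤g = ≤-refl
sum-mono-≤ {ℕ.suc n} f≤g = +-mono-≤ (f≤g zero) (sum-mono-≤ (f≤g ∘ suc))

sum-const : ∀ n p → ∑[ i < n ] p ≡ fromℕ n * p
sum-const ℕ.zero    p = sym (*-zeroˡ p)
sum-const (ℕ.suc n) p = begin-equality
  p + ∑[ i < n ] p      ≡⟨ cong (_+_ p) (sum-const n p) ⟩
  p + fromℕ n * p       ≡⟨ solve 2 (λ p m → p :+ m :* p := (con 1ℚ :+ m) :* p) refl p (fromℕ n) ⟩
  (1ℚ + fromℕ n) * p    ≡⟨ cong (_* p) (fromℕ-suc n) ⟨
  fromℕ (ℕ.suc n) * p   ∎
  where open ≤-Reasoning

-- Indicators and Kronecker deltas.

indicator : ∀ {p} {P : Set p} → Dec P → ℚ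
indicator P? = if does P? then 1ℚ else 0ℚ

⟦_≡_⟧ : ∀ {n} → Fin n → Fin n → ℚ
⟦ a ≡ b ⟧ = indicator (a ≟ b)

-- The sifting property of the Kronecker delta. The induction needs no rewriting of indicators: they
-- read only `does`, and the Boolean of `suc a ≟ suc b` computes to that of `a ≟ b`.
sum-⟦≡⟧-* : ∀ {n} (a : Fin n) (f : Fin n → ℚ) → ∑[ b < n ] (⟦ a ≡ b ⟧ * f b) ≡ f a
sum-⟦≡⟧-* {ℕ.suc n} zero f = begin-equality
  1ℚ * f zero + ∑[ b < n ] (0ℚ * f (suc b))  ≡⟨ cong₂ _+_ (*-identityˡ (f zero)) (sym (*-distribˡ-sum 0ℚ (f ∘ suc))) ⟩
  f zero + 0ℚ * sum (f ∘ suc)                ≡⟨ cong (_+_ (f zero)) (*-zeroˡ (sum (f ∘ suc))) ⟩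
  f zero + 0ℚ                                ≡⟨ +-identityʳ (f zero) ⟩
  f zero                                     ∎
  where open ≤-Reasoning
sum-⟦≡⟧-* {ℕ.suc n} (suc a) f = begin-equality
  0ℚ * f zero + ∑[ b < n ] (⟦ a ≡ b ⟧ * f (suc b))  ≡⟨ cong₂ _+_ (*-zeroˡ (f zero)) (sum-⟦≡⟧-* a (f ∘ suc)) ⟩
  0ℚ + f (suc a)                                    ≡⟨ +-identityˡ (f (suc a)) ⟩
  f (suc a)                                         ∎
  where open ≤-Reasoning

sum-⟦≡⟧ : ∀ {n} (a : Fin n) → ∑[ b < n ] ⟦ a ≡ b ⟧ ≡ 1ℚ
sum-⟦≡⟧ a = trans (sum-cong-≗ λ b → sym (*-identityʳ ⟦ a ≡ b ⟧)) (sum-⟦≡⟧-* a (λ _ → 1ℚ))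

-- Fibres of a map between finite sets.

module _ {M n} (g : Fin M → Fin n) where

  fibreSize : Fin n → ℚ
  fibreSize a = ∑[ x < M ] ⟦ g x ≡ a ⟧

  sum-fibreSize : sum fibreSize ≡ fromℕ M
  sum-fibreSize = begin-equality
    ∑[ a < n ] ∑[ x < M ] ⟦ g x ≡ a ⟧  ≡⟨ ∑-comm (λ a x → ⟦ g x ≡ a ⟧) ⟩
    ∑[ x < M ] ∑[ a < n ] ⟦ g x ≡ a ⟧  ≡⟨ sum-cong-≗ (sum-⟦≡⟧ ∘ g) ⟩
    ∑[ x < M ] 1ℚ                      ≡⟨ sum-const M 1ℚ ⟩
    fromℕ M * 1ℚ                       ≡⟨ *-identityʳ (fromℕ M) ⟩
    fromℕ M                            ∎
    where open ≤-Reasoning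

  -- Counts ordered pairs with equal image, the diagonal included. The orientation `g y ≡ g x` is
  -- the one obtained by evaluating `fibreSize` at `g x`.
  collisions : ℚ
  collisions = ∑[ x < M ] ∑[ y < M ] ⟦ g y ≡ g x ⟧

  -- Only one factor of each square is expanded over x; after exchanging the sums, sifting replaces
  -- a by `g x` in the other factor.
  sum-fibreSize² : ∑[ a < n ] (fibreSize a * fibreSize a) ≡ collisions
  sum-fibreSize² = begin-equality
    ∑[ a < n ] (fibreSize a * fibreSize a)               ≡⟨ sum-cong-≗ (λ a → *-distribʳ-sum (fibreSize a) (λ x → ⟦ g x ≡ a ⟧)) ⟩
    ∑[ a < n ] ∑[ x < M ] (⟦ g x ≡ a ⟧ * fibreSize a)    ≡⟨ ∑-comm (λ a x → ⟦ g x ≡ a ⟧ * fibreSize a) ⟩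
    ∑[ x < M ] ∑[ a < n ] (⟦ g x ≡ a ⟧ * fibreSize a)    ≡⟨ sum-cong-≗ (λ x → sum-⟦≡⟧-* (g x) fibreSize) ⟩
    collisions                                           ∎
    where open ≤-Reasoning

  -- Compares each fibre size m with the average s = M / n through 2 s m ≤ m² + s².
  collisions-lowerBound : ∀ t → fromℕ n * t ≡ 1ℚ → fromℕ M * fromℕ M * t ≤ collisions
  collisions-lowerBound t nt≡1 = begin
    -- Since s = m t, this is 2 s m minus m² t: the first part is the sum of the cross terms 2 s
    -- F(a), and the second will cancel the sum of the s².
    m * m * t                                             ≡⟨ solve 2 (λ m t → m :* m :* t := m :* t :* m :+ m :* t :* m :- m :* m :* t) refl m t ⟩
    s * m + s * m - m * m * t                             ≡⟨ cong (_- m * m * t) sum-2sm ⟨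
    ∑[ a < n ] (s * F a + s * F a) - m * m * t            ≤⟨ +-monoˡ-≤ (- (m * m * t)) (sum-mono-≤ λ a → 2pq≤p²+q² s (F a)) ⟩
    ∑[ a < n ] (F a * F a + s * s) - m * m * t            ≡⟨ cong (_- m * m * t) sum-m²+s² ⟩
    collisions + m * m * t - m * m * t                    ≡⟨ solve 2 (λ c p → c :+ p :- p := c) refl collisions (m * m * t) ⟩
    collisions                                            ∎
    where
    open ≤-Reasoning
    m = fromℕ M
    s = m * t
    F = fibreSize

    sum-sm : ∑[ a < n ] (s * F a) ≡ s * m
    sum-sm = trans (sym (*-distribˡ-sum s F)) (cong (s *_) sum-fibreSize)

    sum-2sm : ∑[ a < n ] (s * F a + s * F a) ≡ s * m + s * m
    sum-2sm = trans (∑-distrib-+ (λ a → s * F a) (λ a → s * F a)) (cong₂ _+_ sum-sm sum-sm)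

    sum-s² : ∑[ a < n ] (s * s) ≡ m * m * t
    sum-s² = begin-equality
      ∑[ a < n ] (s * s)        ≡⟨ sum-const n (s * s) ⟩
      fromℕ n * (s * s)         ≡⟨ solve 3 (λ k m t → k :* (m :* t :* (m :* t)) := k :* t :* (m :* m :* t)) refl (fromℕ n) m t ⟩
      fromℕ n * t * (m * m * t) ≡⟨ cong (_* (m * m * t)) nt≡1 ⟩
      1ℚ * (m * m * t)          ≡⟨ *-identityˡ (m * m * t) ⟩
      m * m * t                 ∎

    sum-m²+s² : ∑[ a < n ] (F a * F a + s * s) ≡ collisions + m * m * t
    sum-m²+s² = trans (∑-distrib-+ (λ a → F a * F a) (λ _ → s * s)) (cong₂ _+_ sum-fibreSize² sum-s²)

-- Distance against agreement, and sums with one exceptional term.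

-- Each index contributes exactly once, to the count or to the indicator sum. A general `f` in place
-- of `id` lets the induction pass to `f ∘ suc`.
count-¬+sum-indicator : ∀ {a p} {A : Set a} {P : Pred A p} (P? : Decidable P) {n} (f : Fin n → A) →
  fromℕ (count (¬? ∘ P?) (tabulate f)) + ∑[ i < n ] indicator (P? (f i)) ≡ fromℕ n
count-¬+sum-indicator P? {ℕ.zero}  f = refl
count-¬+sum-indicator P? {ℕ.suc n} f
  with does (P? (f zero)) | count-¬+sum-indicator P? (f ∘ suc)
... | true  | ih = begin-equality
  c + (1ℚ + σ)      ≡⟨ solve 2 (λ c σ → c :+ (con 1ℚ :+ σ) := con 1ℚ :+ (c :+ σ)) refl c σ ⟩
  1ℚ + (c + σ)      ≡⟨ cong (_+_ 1ℚ) ih ⟩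
  1ℚ + fromℕ n      ≡⟨ fromℕ-suc n ⟨
  fromℕ (ℕ.suc n)   ∎
  where
  open ≤-Reasoning
  c = fromℕ (count (¬? ∘ P?) (tabulate (f ∘ suc)))
  σ = ∑[ i < n ] indicator (P? (f (suc i)))
... | false | ih = begin-equality
  fromℕ (ℕ.suc k) + (0ℚ + σ)  ≡⟨ cong (_+ (0ℚ + σ)) (fromℕ-suc k) ⟩
  1ℚ + fromℕ k + (0ℚ + σ)     ≡⟨ solve 2 (λ c σ → con 1ℚ :+ c :+ (con 0ℚ :+ σ) := con 1ℚ :+ (c :+ σ)) refl (fromℕ k) σ ⟩
  1ℚ + (fromℕ k + σ)          ≡⟨ cong (_+_ 1ℚ) ih ⟩
  1ℚ + fromℕ n                ≡⟨ fromℕ-suc n ⟨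
  fromℕ (ℕ.suc n)             ∎
  where
  open ≤-Reasoning
  k = count (¬? ∘ P?) (tabulate (f ∘ suc))
  σ = ∑[ i < n ] indicator (P? (f (suc i)))

hamming+agreements : ∀ {d} {ns : Vec ℕ d} (x y : HS ns) →
  fromℕ (hamming x y) + ∑[ i < d ] ⟦ lookup⁺ x i ≡ lookup⁺ y i ⟧ ≡ fromℕ d
hamming+agreements x y = count-¬+sum-indicator (λ i → lookup⁺ x i ≟ lookup⁺ y i) id

-- Adding δ to the term at `y`, in the form of a Kronecker delta, lifts every term to at least δ and
-- costs a single δ in total.
sum-≥-except-one : ∀ {M} (f : Fin M → ℚ) y δ → 0ℚ ≤ f y → (∀ x → x ≢ y → δ ≤ f x) →
  fromℕ M * δ ≤ δ + sum f
sum-≥-except-one {M} f y δ 0≤fy δ≤f = begin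
  fromℕ M * δ                              ≡⟨ sum-const M δ ⟨
  ∑[ x < M ] δ                             ≤⟨ sum-mono-≤ pointwise ⟩
  ∑[ x < M ] (⟦ y ≡ x ⟧ * δ + f x)         ≡⟨ ∑-distrib-+ (λ x → ⟦ y ≡ x ⟧ * δ) f ⟩
  ∑[ x < M ] (⟦ y ≡ x ⟧ * δ) + sum f       ≡⟨ cong (_+ sum f) (sum-⟦≡⟧-* y (λ _ → δ)) ⟩
  δ + sum f                                ∎
  where
  open ≤-Reasoning
  pointwise : ∀ x → δ ≤ ⟦ y ≡ x ⟧ * δ + f x
  pointwise x with y ≟ x
  ... | yes refl = begin
    δ              ≡⟨ solve 1 (λ δ → δ := con 1ℚ :* δ :+ con 0ℚ) refl δ ⟩
    1ℚ * δ + 0ℚ    ≤⟨ +-monoʳ-≤ (1ℚ * δ) 0≤fy ⟩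
    1ℚ * δ + f x   ∎
  ... | no y≢x = begin
    δ              ≤⟨ δ≤f x (y≢x ∘ sym) ⟩
    f x            ≡⟨ solve 2 (λ δ p → p := con 0ℚ :* δ :+ p) refl δ (f x) ⟩
    0ℚ * δ + f x   ∎

-- Double counting of the distances in a code.

module _ {d M} {ns : Vec ℕ d} (c : Fin M → HS ns) where

  totalDistance : ℚ
  totalDistance = ∑[ x < M ] ∑[ y < M ] fromℕ (hamming (c y) (c x))

  coordinate : ∀ i → Fin M → Fin (lookup ns i)
  coordinate i x = lookup⁺ (c x) i

  -- For each fixed x the exceptional term is the diagonal pair (x, x). The bound M (M - 1) δ is
  -- kept free of subtraction by moving M δ to the right.
  totalDistance-lowerBound : ∀ δ → (∀ x y → x ≢ y → δ ≤ fromℕ (hamming (c x) (c y))) →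
    fromℕ M * (fromℕ M * δ) ≤ fromℕ M * δ + totalDistance
  totalDistance-lowerBound δ δ≤ = begin
    fromℕ M * (fromℕ M * δ)                                       ≡⟨ sum-const M (fromℕ M * δ) ⟨
    ∑[ x < M ] (fromℕ M * δ)                                      ≤⟨ sum-mono-≤ (λ x → sum-≥-except-one (dist x) x δ (fromℕ-nonNeg (hamming (c x) (c x))) (λ y → δ≤ y x)) ⟩
    ∑[ x < M ] (δ + sum (dist x))                                 ≡⟨ ∑-distrib-+ (λ _ → δ) (λ x → sum (dist x)) ⟩
    ∑[ x < M ] δ + totalDistance                                  ≡⟨ cong (_+ totalDistance) (sum-const M δ) ⟩
    fromℕ M * δ + totalDistance                                   ∎
    where
    open ≤-Reasoning
    dist : Fin M → Fin M → ℚ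
    dist x y = fromℕ (hamming (c y) (c x))

  -- Each of the M² ordered pairs contributes d, because every coordinate either differs or agrees.
  -- The exchanges of sums bring the coordinate index innermost.
  totalDistance+collisions :
    totalDistance + ∑[ i < d ] collisions (coordinate i) ≡ fromℕ M * (fromℕ M * fromℕ d)
  totalDistance+collisions = begin-equality
    totalDistance + ∑[ i < d ] ∑[ x < M ] ∑[ y < M ] agree i x y        ≡⟨ cong (_+_ totalDistance) (∑-comm (λ i x → ∑[ y < M ] agree i x y)) ⟩
    totalDistance + ∑[ x < M ] ∑[ i < d ] ∑[ y < M ] agree i x y        ≡⟨ cong (_+_ totalDistance) (sum-cong-≗ λ x → ∑-comm (λ i y → agree i x y)) ⟩
    totalDistance + ∑[ x < M ] ∑[ y < M ] ∑[ i < d ] agree i x y        ≡⟨ ∑-distrib-+ (λ x → sum (dist x)) (λ x → ∑[ y < M ] ∑[ i < d ] agree i x y) ⟨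
    ∑[ x < M ] (sum (dist x) + ∑[ y < M ] ∑[ i < d ] agree i x y)       ≡⟨ sum-cong-≗ (λ x → sym (∑-distrib-+ (dist x) (λ y → ∑[ i < d ] agree i x y))) ⟩
    ∑[ x < M ] ∑[ y < M ] (dist x y + ∑[ i < d ] agree i x y)           ≡⟨ sum-cong-≗ (λ x → sum-cong-≗ λ y → hamming+agreements (c y) (c x)) ⟩
    ∑[ x < M ] ∑[ y < M ] fromℕ d                                       ≡⟨ sum-cong-≗ {M} (λ _ → sum-const M (fromℕ d)) ⟩
    ∑[ x < M ] (fromℕ M * fromℕ d)                                      ≡⟨ sum-const M (fromℕ M * fromℕ d) ⟩
    fromℕ M * (fromℕ M * fromℕ d)                                       ∎
    where
    open ≤-Reasoning
    dist : Fin M → Fin M → ℚ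
    dist x y = fromℕ (hamming (c y) (c x))
    agree : Fin d → Fin M → Fin M → ℚ
    agree i x y = ⟦ coordinate i y ≡ coordinate i x ⟧

  module _ (ns≥1 : ∀ i → 1 ≤ℕ lookup ns i) where

    -- Agrees definitionally with the summand of `ratio`, so that `ratio ns ns≥1` unfolds to
    -- `1ℚ - sum 1/dn`.
    1/dn : Fin d → ℚ
    1/dn i = (+ 1 ℚ./ (d ℕ.* lookup ns i)) {{m*n≢0 d (lookup ns i) {{nonZeroIndex i}} {{ℕ.>-nonZero (ns≥1 i)}}}}

    -- Allows `fromℕ d * 1/dn i` to serve as the reciprocal `t` of nᵢ in `collisions-lowerBound`.
    n*d*1/dn≡1 : ∀ i → fromℕ (lookup ns i) * (fromℕ d * 1/dn i) ≡ 1ℚ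
    n*d*1/dn≡1 i = begin-equality
      fromℕ n * (fromℕ d * 1/dn i)   ≡⟨ solve 3 (λ n d q → n :* (d :* q) := d :* n :* q) refl (fromℕ n) (fromℕ d) (1/dn i) ⟩
      fromℕ d * fromℕ n * 1/dn i     ≡⟨ cong (_* 1/dn i) (fromℕ-* d n) ⟨
      fromℕ (d ℕ.* n) * 1/dn i       ≡⟨ fromℕ-*-1/ (d ℕ.* n) {{m*n≢0 d n {{nonZeroIndex i}} {{ℕ.>-nonZero (ns≥1 i)}}}} ⟩
      1ℚ                             ∎
      where
      open ≤-Reasoning
      n = lookup ns i

    sum-collisions-lowerBound :
      fromℕ M * fromℕ M * (fromℕ d * sum 1/dn) ≤ ∑[ i < d ] collisions (coordinate i)
    sum-collisions-lowerBound = begin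
      m² * (fromℕ d * sum 1/dn)                ≡⟨ cong (m² *_) (*-distribˡ-sum (fromℕ d) 1/dn) ⟩
      m² * ∑[ i < d ] (fromℕ d * 1/dn i)       ≡⟨ *-distribˡ-sum m² (λ i → fromℕ d * 1/dn i) ⟩
      ∑[ i < d ] (m² * (fromℕ d * 1/dn i))     ≤⟨ sum-mono-≤ (λ i → collisions-lowerBound (coordinate i) (fromℕ d * 1/dn i) (n*d*1/dn≡1 i)) ⟩
      ∑[ i < d ] collisions (coordinate i)     ∎
      where
      open ≤-Reasoning
      m² = fromℕ M * fromℕ M

    totalDistance-upperBound : totalDistance ≤ fromℕ M * (fromℕ M * (ratio ns ns≥1 * fromℕ d))
    totalDistance-upperBound = begin
      D                                             ≡⟨ solve 2 (λ D A → D := D :+ A :- A) refl D A ⟩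
      D + A - A                                     ≡⟨ cong (_- A) totalDistance+collisions ⟩
      m * (m * fromℕ d) - A                         ≤⟨ +-monoʳ-≤ (m * (m * fromℕ d)) (neg-antimono-≤ sum-collisions-lowerBound) ⟩
      m * (m * fromℕ d) - m * m * (fromℕ d * S)     ≡⟨ solve 3 (λ m d s → m :* (m :* d) :- m :* m :* (d :* s) := m :* (m :* ((con 1ℚ :- s) :* d))) refl m (fromℕ d) S ⟩
      m * (m * (ratio ns ns≥1 * fromℕ d))           ∎
      where
      open ≤-Reasoning
      m = fromℕ M
      D = totalDistance
      A = ∑[ i < d ] collisions (coordinate i)
      S = sum 1/dn

    -- In the comparison of the two bounds the total distance cancels, and both sides keep a common
    -- factor M, which is positive by `M≥1` and can be divided out.
    plotkin : ∀ δ → 1 ≤ℕ M → (∀ x y → x ≢ y → δ ≤ fromℕ (hamming (c x) (c y))) →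
      fromℕ M * (δ - ratio ns ns≥1 * fromℕ d) ≤ δ
    plotkin δ M≥1 δ≤ = *-cancelˡ-≤-pos m {{normalize-pos M 1 {{_}} {{ℕ.>-nonZero M≥1}}}} (begin
      m * (m * (δ - rd))                            ≡⟨ solve 3 (λ m δ r → m :* (m :* (δ :- r)) := m :* (m :* δ) :- m :* (m :* r)) refl m δ rd ⟩
      m * (m * δ) - m * (m * rd)                    ≤⟨ +-mono-≤ (totalDistance-lowerBound δ δ≤) (neg-antimono-≤ totalDistance-upperBound) ⟩
      m * δ + totalDistance - totalDistance         ≡⟨ solve 2 (λ p D → p :+ D :- D := p) refl (m * δ) totalDistance ⟩
      m * δ                                         ∎)
      where
      open ≤-Reasoning
      m = fromℕ M
      rd = ratio ns ns≥1 * fromℕ d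

-- From lists to indexed families, and the final division.

lookup-injective : ∀ {a} {A : Set a} {xs : List A} → Unique xs → Injective _≡_ _≡_ (List.lookup xs)
lookup-injective (x∉ ∷ _)  {zero}  {zero}  eq = refl
lookup-injective (x∉ ∷ _)  {zero}  {suc j} eq = contradiction eq (All.lookup x∉ (∈-lookup j))
lookup-injective (x∉ ∷ _)  {suc i} {zero}  eq = contradiction (sym eq) (All.lookup x∉ (∈-lookup i))
lookup-injective (_ ∷ uxs) {suc i} {suc j} eq = cong suc (lookup-injective uxs eq)

*≤⇒≤÷ : ∀ p q r .{{_ : ℚ.Positive r}} → p * r ≤ q → p ≤ (q ÷ r) {{pos⇒nonZero r}}
*≤⇒≤÷ p q r pr≤q = *-cancelʳ-≤-pos r (begin
  p * r              ≤⟨ pr≤q ⟩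
  q                  ≡⟨ *-identityʳ q ⟨
  q * 1ℚ             ≡⟨ cong (q *_) (*-inverseˡ r) ⟨
  q * (1/ r * r)     ≡⟨ *-assoc q (1/ r) r ⟨
  (q ÷ r) * r        ∎)
  where
  open ≤-Reasoning
  instance _ = pos⇒nonZero r

p<q⇒q-p-pos : ∀ {p q} → p < q → ℚ.Positive (q - p)
p<q⇒q-p-pos {p} {q} p<q = ℚ.positive (subst (_< q - p) (+-inverseʳ p) (+-monoˡ-< (- p) p<q))

mainTheorem10 : (d : ℕ) (ns : Vec ℕ d) (ns≥1 : ∀ i → 1 ≤ℕ lookup ns i)
    (δ : ℚ) → 0ℚ < δ →
    (C : List (HS ns)) → Unique C → 1 ≤ℕ length C →
    (∀ {x y} → x ∈ C → y ∈ C → x ≢ y → δ ≤ fromℕ (hamming x y)) →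
    (rd<δ : ratio ns ns≥1 * fromℕ d < δ) →
    + length C ≤ℤ floor ((δ ÷ (δ - ratio ns ns≥1 * fromℕ d)) {{q<p⇒p-q≢0 rd<δ}})
mainTheorem10 d ns ns≥1 δ _ C C-unique C≥1 δ≤hamming rd<δ =
  fromℕ≤⇒≤floor (length C) _
    (*≤⇒≤÷ (fromℕ (length C)) δ (δ - ratio ns ns≥1 * fromℕ d) {{p<q⇒q-p-pos rd<δ}}
      -- The code enters as the family of its entries indexed by position; `Unique` makes distinct
      -- positions carry distinct codewords.
      (plotkin (List.lookup C) ns≥1 δ C≥1 λ x y x≢y →
        δ≤hamming (∈-lookup x) (∈-lookup y) (x≢y ∘ lookup-injective C-unique)))
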